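{- The period-doubling word $\mathbf{d}$ is good.
   Context: The period-doubling word $\mathbf{d}=01000101010001000100010101000101\cdots$ is the one-sided infinite fixed point, beginning with $0$, of the morphism $\delta$ with $\delta(0)=01$, $\delta(1)=00$. A factor of a word is a finite contiguous subword. A word $w$ encounters a pattern $p\in\{0,1\}^*$ if $g(p)$ is a factor of $w$ for some non-erasing morphism $g:\{0,1\}^*\to\{0,1\}^*$ (i.e. $g(0),g(1)$ non-empty). A (finite or one-sided infinite) binary word is good if it contains neither $11$ nor $1001$ as a factor, and encounters neither of the patterns $0000$ and $00010100$. -}

module Defs where

open import Data.Digit using (Bit)
open import Data.Fin using (fromℕ<; opposite)
open import Data.Fin.Patterns using (0F; 1F)
open import Data.List using (List; []; _∷_; _++_; concatMap; applyUpTo; length; lookup)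
open import Data.List.Properties using (concatMap-++; length-applyUpTo)
open import Data.Nat using (ℕ; zero; suc; _+_; _<_; z≤n; s≤s)
open import Data.Nat.Properties using (+-suc; +-comm; +-mono-≤; ≤-trans)
open import Data.Product using (∃-syntax; _×_; _,_)
open import Relation.Binary.PropositionalEquality using (_≡_; _≢_; refl; sym; trans; cong; cong₂; subst)
open import Relation.Nullary using (¬_)

Word : Set
Word = List Bit

-- One-sided infinite words, indexed from 0.
Word∞ : Set
Word∞ = ℕ → Bit

-- A morphism of the free monoid {0,1}* is given by the images of the letters;
-- its action on words is _⟨_⟩.
Morphism : Set
Morphism = Bit → Word

infix 8 _⟨_⟩
_⟨_⟩ : Morphism → Word → Word
h ⟨ u ⟩ = concatMap h u

NonErasing : Morphism → Set
NonErasing h = ∀ a → h a ≢ []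

prefix : Word∞ → ℕ → Word
prefix = applyUpTo

infix 4 _IsFactorOf_
_IsFactorOf_ : Word → Word∞ → Set
u IsFactorOf w = ∃[ i ] u ≡ applyUpTo (λ j → w (i + j)) (length u)

Encounters : Word∞ → Word → Set
Encounters w p = ∃[ g ] NonErasing g × g ⟨ p ⟩ IsFactorOf w

record Good (w : Word∞) : Set where
  field
    no-11           : ¬ (1F ∷ 1F ∷ []) IsFactorOf w
    no-1001         : ¬ (1F ∷ 0F ∷ 0F ∷ 1F ∷ []) IsFactorOf w
    avoids-0000     : ¬ Encounters w (0F ∷ 0F ∷ 0F ∷ 0F ∷ [])
    avoids-00010100 : ¬ Encounters w (0F ∷ 0F ∷ 0F ∷ 1F ∷ 0F ∷ 1F ∷ 0F ∷ 0F ∷ [])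

-- w = h(w): the image under h of every prefix of w is again a prefix of w.
-- For non-erasing h these images have unbounded length, so they determine h(w).
IsFixedPoint : Morphism → Word∞ → Set
IsFixedPoint h w = ∀ n → let v = h ⟨ prefix w n ⟩ in v ≡ prefix w (length v)

δ : Morphism
δ 0F = 0F ∷ 1F ∷ []
δ 1F = 0F ∷ 0F ∷ []

δ^_⟨0⟩ : ℕ → Word
δ^ zero  ⟨0⟩ = 0F ∷ []
δ^ suc n ⟨0⟩ = δ ⟨ δ^ n ⟨0⟩ ⟩

length-δ : ∀ u → length (δ ⟨ u ⟩) ≡ length u + length u
length-δ []       = refl
length-δ (0F ∷ u) = cong suc (trans (cong suc (length-δ u)) (sym (+-suc (length u) (length u))))
length-δ (1F ∷ u) = cong suc (trans (cong suc (length-δ u)) (sym (+-suc (length u) (length u))))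

n<length-δ^n : ∀ n → n < length δ^ n ⟨0⟩
n<length-δ^n zero = s≤s z≤n
n<length-δ^n (suc n) rewrite length-δ δ^ n ⟨0⟩ =
  +-mono-≤ (≤-trans (s≤s z≤n) (n<length-δ^n n)) (n<length-δ^n n)

-- d is the limit of the words δⁿ(0), each of which is a prefix of the next.
-- The results d-starts-with-0, d-fixed and d-unique show that d is the unique
-- fixed point of δ beginning with 0.
d : Word∞
d n = lookup δ^ n ⟨0⟩ (fromℕ< (n<length-δ^n n))

d-starts-with-0 : d 0 ≡ 0F
d-starts-with-0 = refl

private
  -- The letter of u at position i is a.
  data At : Word → ℕ → Bit → Set where
    here  : ∀ {a u} → At (a ∷ u) 0 a
    there : ∀ {a b u i} → At u i a → At (b ∷ u) (suc i) a

  at-unique : ∀ {u i a b} → At u i a → At u i b → a ≡ b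
  at-unique here      here      = refl
  at-unique (there p) (there q) = at-unique p q

  at-lookup : ∀ u {i} (i<n : i < length u) → At u i (lookup u (fromℕ< i<n))
  at-lookup (a ∷ u) {zero}  i<n       = here
  at-lookup (a ∷ u) {suc i} (s≤s i<n) = there (at-lookup u i<n)

  at-++ : ∀ {u i a} v → At u i a → At (u ++ v) i a
  at-++ v here      = here
  at-++ v (there p) = there (at-++ v p)

  at-prefix : ∀ w {n i} → i < n → At (prefix w n) i (w i)
  at-prefix w {i = zero}  (s≤s _)   = here
  at-prefix w {i = suc i} (s≤s i<n) = there (at-prefix (λ j → w (suc j)) i<n)

  at-even : ∀ {u i a} → At u i a → At (δ ⟨ u ⟩) (i + i) 0F
  at-even {a = 0F} here = here
  at-even {a = 1F} here = here
  at-even {0F ∷ _} {suc i} (there p) rewrite +-suc i i = there (there (at-even p))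
  at-even {1F ∷ _} {suc i} (there p) rewrite +-suc i i = there (there (at-even p))

  at-odd : ∀ {u i a} → At u i a → At (δ ⟨ u ⟩) (suc (i + i)) (opposite a)
  at-odd {a = 0F} here = there here
  at-odd {a = 1F} here = there here
  at-odd {0F ∷ _} {suc i} (there p) rewrite +-suc i i = there (there (at-odd p))
  at-odd {1F ∷ _} {suc i} (there p) rewrite +-suc i i = there (there (at-odd p))

  δ^-step : ∀ n → ∃[ v ] δ^ suc n ⟨0⟩ ≡ δ^ n ⟨0⟩ ++ v
  δ^-step zero    = 1F ∷ [] , refl
  δ^-step (suc n) with δ^-step n
  ... | v , eq = δ ⟨ v ⟩ , trans (cong (δ ⟨_⟩) eq) (concatMap-++ δ δ^ n ⟨0⟩ v)

  at-later : ∀ k {n i a} → At δ^ n ⟨0⟩ i a → At δ^ k + n ⟨0⟩ i a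
  at-later zero    p = p
  at-later (suc k) {n} {i} {a} p with δ^-step (k + n)
  ... | v , eq = subst (λ u → At u i a) (sym eq) (at-++ v (at-later k p))

  at-d : ∀ i → At δ^ i ⟨0⟩ i (d i)
  at-d i = at-lookup δ^ i ⟨0⟩ (n<length-δ^n i)

  d-at : ∀ n {i a} → At δ^ n ⟨0⟩ i a → d i ≡ a
  d-at n {i} {a} p = at-unique (at-later n (at-d i))
    (subst (λ k → At δ^ k ⟨0⟩ i a) (+-comm i n) (at-later i p))

  δ-prefix : ∀ f g → (∀ i → f (i + i) ≡ 0F) → (∀ i → f (suc (i + i)) ≡ opposite (g i)) →
             ∀ n → δ ⟨ prefix g n ⟩ ≡ prefix f (n + n)
  δ-prefix f g even odd zero    = refl
  δ-prefix f g even odd (suc n) rewrite +-suc n n =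
    trans (δ-∷ (g 0) (prefix (λ i → g (suc i)) n))
      (cong₂ _∷_ (sym (even 0)) (cong₂ _∷_ (sym (odd 0))
        (δ-prefix (λ i → f (suc (suc i))) (λ i → g (suc i))
          (λ i → trans (cong (λ k → f (suc k)) (sym (+-suc i i))) (even (suc i)))
          (λ i → trans (cong (λ k → f (suc (suc k))) (sym (+-suc i i))) (odd (suc i)))
          n)))
    where
    δ-∷ : ∀ a u → δ ⟨ a ∷ u ⟩ ≡ 0F ∷ opposite a ∷ δ ⟨ u ⟩
    δ-∷ 0F u = refl
    δ-∷ 1F u = refl

d-even : ∀ i → d (i + i) ≡ 0F
d-even i = d-at (suc i) (at-even (at-d i))

d-odd : ∀ i → d (suc (i + i)) ≡ opposite (d i)
d-odd i = d-at (suc i) (at-odd (at-d i))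

d-fixed : IsFixedPoint δ d
d-fixed n = trans eq (cong (prefix d) (sym (trans (cong length eq) (length-applyUpTo d (n + n)))))
  where
  eq : δ ⟨ prefix d n ⟩ ≡ prefix d (n + n)
  eq = δ-prefix d d d-even d-odd n

d-unique : ∀ w → w 0 ≡ 0F → IsFixedPoint δ w → ∀ n → w n ≡ d n
d-unique w w0 fixed n = at-unique
  (subst (λ u → At u n (w n)) (sym (δ^-prefix n)) (at-prefix w (n<length-δ^n n))) (at-d n)
  where
  δ^-prefix : ∀ m → δ^ m ⟨0⟩ ≡ prefix w (length δ^ m ⟨0⟩)
  δ^-prefix zero    = cong (_∷ []) (sym w0)
  δ^-prefix (suc m) = subst (λ u → δ ⟨ u ⟩ ≡ prefix w (length (δ ⟨ u ⟩)))
    (sym (δ^-prefix m)) (fixed (length δ^ m ⟨0⟩))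

{-# OPTIONS --safe #-}
module Submission where

-- The odd positions of d carry the complement of d itself, so an encounter of a
-- pattern all of whose letters have images of even length desubstitutes to one
-- with images of half the length. Hence it suffices to exclude encounters with an
-- image of odd length. There u = g(0), which occurs at two positions of opposite
-- parity, consists of zeros only, and uu occurs while 0000 does not, so u = 0. The
-- remaining case 000v0v00 is excluded because the zeros of d at odd positions lie
-- at positions congruent to 3 modulo 4.

open import Defs
open import Data.Empty using (⊥; ⊥-elim)
open import Data.Fin using (opposite)
open import Data.Fin.Patterns using (0F; 1F)
open import Data.Fin.Properties using (opposite-involutive)
open import Data.List using ([]; _∷_; _++_; length; applyUpTo)
open import Data.List.Relation.Unary.All using (All; []; _∷_)
open import Data.Nat using (ℕ; suc; _+_; _<_; ⌊_/2⌋; parity; s<s; s≤s; z≤n)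
open import Data.Nat.Induction using (Acc; acc; <-wellFounded)
open import Data.Nat.Properties using (+-comm; +-identityʳ; +-suc; m≤n⇒m≤1+n)
open import Data.Nat.Tactic.RingSolver using (solve-∀)
open import Data.Parity.Base as ℙ using (Parity; 0ℙ; 1ℙ)
open import Data.Parity.Properties using (+-homo-+)
open import Data.Product using (∃-syntax; _×_; _,_)
open import Data.Unit using (⊤; tt)
open import Function using (_∘_; case_of_)
open import Relation.Binary.PropositionalEquality
  using (_≡_; _≢_; refl; sym; trans; cong; cong₂; subst)
open import Relation.Nullary using (¬_)

even-half : ∀ n → parity n ≡ 0ℙ → ∃[ k ] n ≡ k + k
even-half 0             _ = 0 , refl
even-half (suc (suc n)) p with even-half n p
... | k , refl = suc k , cong suc (sym (+-suc k k))

odd-half : ∀ n → parity n ≡ 1ℙ → n ≡ suc (⌊ n /2⌋ + ⌊ n /2⌋)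
odd-half 1             _ = refl
odd-half (suc (suc n)) p = cong suc (cong suc (trans (odd-half n p) (sym (+-suc ⌊ n /2⌋ ⌊ n /2⌋))))

parity-double : ∀ k → parity (k + k) ≡ 0ℙ
parity-double 0 = refl
parity-double (suc k) rewrite +-suc k k = parity-double k

parity-suc : ∀ n → parity (suc n) ≡ parity n ℙ.⁻¹
parity-suc = +-homo-+ 1

d-at-even : ∀ n → parity n ≡ 0ℙ → d n ≡ 0F
d-at-even n p with even-half n p
... | k , refl = d-even k

d-at-odd : ∀ n → parity n ≡ 1ℙ → d n ≡ opposite (d ⌊ n /2⌋)
d-at-odd n p = trans (cong d (odd-half n p)) (d-odd ⌊ n /2⌋)

one-at-odd : ∀ n → d n ≡ 1F → parity n ≡ 1ℙ
one-at-odd n dn≡1 with parity n in p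
... | 1ℙ = refl
... | 0ℙ with () ← trans (sym dn≡1) (d-at-even n p)

-- The letter `d k` is then 1, and ones occur only at odd positions.
zero-at-2k+1 : ∀ k → 0F ≡ d (suc (k + k)) → parity k ≡ 1ℙ
zero-at-2k+1 k z = one-at-odd k
  (trans (sym (opposite-involutive (d k))) (cong opposite (sym (trans z (d-odd k)))))

zero-at-odd : ∀ n → parity n ≡ 1ℙ → 0F ≡ d n → parity ⌊ n /2⌋ ≡ 1ℙ
zero-at-odd n p z = zero-at-2k+1 ⌊ n /2⌋ (trans z (cong d (odd-half n p)))

odd-suc-not-odd : ∀ n → parity n ≡ 1ℙ → parity (suc n) ≢ 1ℙ
odd-suc-not-odd n p q with () ← trans (sym q) (trans (parity-suc n) (cong ℙ._⁻¹ p))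

-- Unlike with `IsFactorOf`, matching yields one equation per letter at its absolute position, whose
-- parity drives the arguments.
Occurs : Word → ℕ → Set
Occurs []      x = ⊤
Occurs (a ∷ u) x = a ≡ d x × Occurs u (suc x)

factor⇒occurs : ∀ u → u IsFactorOf d → ∃[ x ] Occurs u x
factor⇒occurs u (i , eq) = i , go u i (λ j → d (i + j)) (λ _ → refl) eq
  where
  -- `f` stays general because `applyUpTo` recurses on `f ∘ suc`.
  go : ∀ u x f → (∀ j → f j ≡ d (x + j)) → u ≡ applyUpTo f (length u) → Occurs u x
  go []      x f h eq = tt
  go (a ∷ u) x f h eq with applyUpTo (f ∘ suc) (length u) in eq′
  go (a ∷ u) x f h refl | _ =
    trans (h 0) (cong d (+-identityʳ x)) ,
    go u (suc x) (f ∘ suc) (λ j → trans (h (suc j)) (cong d (+-suc x j))) (sym eq′)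

occurs-++ : ∀ u {v x} → Occurs (u ++ v) x → Occurs u x × Occurs v (x + length u)
occurs-++ []      {v} {x} o = tt , subst (Occurs v) (sym (+-identityʳ x)) o
occurs-++ (a ∷ u) {v} {x} (e , o) with occurs-++ u o
... | o₁ , o₂ = (e , o₁) , subst (Occurs v) (sym (+-suc x (length u))) o₂

-- The halves of `x` and `2 + x` are consecutive, yet both would have to be odd.
no-zeros-two-apart : ∀ x → parity x ≡ 1ℙ → 0F ≡ d x → 0F ≢ d (2 + x)
no-zeros-two-apart x p z z′ =
  odd-suc-not-odd ⌊ x /2⌋ (zero-at-odd x p z) (zero-at-odd (2 + x) p z′)

-- With `q = 2r + 1` the distance `4 + 2q` is 2 modulo 4, while zeros at odd positions differ by a
-- multiple of 4.
no-odd-zeros-4r+6-apart : ∀ x q → parity x ≡ 0ℙ → parity q ≡ 1ℙ → 0F ≡ d (1 + x) → 0F ≢ d (5 + x + q + q)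
no-odd-zeros-4r+6-apart x q even odd z z′ with even-half x even
... | k , refl = odd-suc-not-odd (k + (r + r))
  (trans (+-homo-+ k (r + r)) (cong₂ ℙ._+_ (zero-at-2k+1 k z) (parity-double r)))
  (zero-at-2k+1 (3 + (k + (r + r))) (trans z′ (cong d
    (trans (cong (λ q → 5 + (k + k) + q + q) (odd-half q odd)) (regroup k r)))))
  where
  r = ⌊ q /2⌋
  regroup : ∀ k r → 5 + (k + k) + suc (r + r) + suc (r + r) ≡ suc (3 + (k + (r + r)) + (3 + (k + (r + r))))
  regroup = solve-∀

-- Of four consecutive positions two are odd, and these are two apart.
no-0000 : ∀ x → ¬ Occurs (0F ∷ 0F ∷ 0F ∷ 0F ∷ []) x
no-0000 x (z₀ , z₁ , z₂ , z₃ , _) with parity x in p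
... | 1ℙ = no-zeros-two-apart x p z₀ z₂
... | 0ℙ = no-zeros-two-apart (suc x) (trans (parity-suc x) (cong ℙ._⁻¹ p)) z₁ z₃

-- In one of the two occurrences each letter stands at an even position, where `d` is 0.
zeros-of-odd-shift : ∀ u {x} n → parity n ≡ 1ℙ → Occurs u x → Occurs u (x + n) → All (_≡ 0F) u
zeros-of-odd-shift []      n odd _ _ = []
zeros-of-odd-shift (a ∷ u) {x} n odd (e , o) (e′ , o′) = a≡0 ∷ zeros-of-odd-shift u n odd o o′
  where
  a≡0 : a ≡ 0F
  a≡0 with parity x in p
  ... | 0ℙ = trans e (d-at-even x p)
  ... | 1ℙ = trans e′ (d-at-even (x + n) (trans (+-homo-+ x n) (cong₂ ℙ._+_ p odd)))

-- A longer `u` would make `u ++ u` start with 0000.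
zeros-square : ∀ u {x} → All (_≡ 0F) u → u ≢ [] → Occurs u x → Occurs u (x + length u) → u ≡ 0F ∷ []
zeros-square []       _           u≢[] _ _ = ⊥-elim (u≢[] refl)
zeros-square (_ ∷ []) (refl ∷ []) _    _ _ = refl
zeros-square (_ ∷ _ ∷ []) {x} (refl ∷ refl ∷ []) _ (z₀ , z₁ , _) o =
  ⊥-elim (no-0000 x (z₀ , z₁ , subst (Occurs _) (+-comm x 2) o))
zeros-square (_ ∷ _ ∷ _ ∷ []) {x} (refl ∷ refl ∷ refl ∷ []) _ (z₀ , z₁ , z₂ , _) (z₃ , _) =
  ⊥-elim (no-0000 x (z₀ , z₁ , z₂ , trans z₃ (cong d (+-comm x 3)) , tt))
zeros-square (_ ∷ _ ∷ _ ∷ _ ∷ _) {x} (refl ∷ refl ∷ refl ∷ refl ∷ _) _ (z₀ , z₁ , z₂ , z₃ , _) _ =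
  ⊥-elim (no-0000 x (z₀ , z₁ , z₂ , z₃ , tt))

odd-shift-square : ∀ u {x} n → parity n ≡ 1ℙ → u ≢ [] →
  Occurs u x → Occurs u (x + length u) → Occurs u (x + n) → u ≡ 0F ∷ []
odd-shift-square u n odd u≢[] o o′ o″ = zeros-square u (zeros-of-odd-shift u n odd o o″) u≢[] o o′

EvenLength : Word → Set
EvenLength u = parity (length u) ≡ 0ℙ

-- Keeps the complements of the letters at odd positions of d when u occurs at a
-- position of parity s. Only even lengths matter; a last unpaired letter is kept
-- so that contraction never erases a nonempty word.
contract : Parity → Word → Word
contract s  []          = []
contract s  (a ∷ [])    = a ∷ []
contract 0ℙ (a ∷ b ∷ u) = opposite b ∷ contract 0ℙ u
contract 1ℙ (a ∷ b ∷ u) = opposite a ∷ contract 1ℙ u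

contract-nonempty : ∀ s u → u ≢ [] → contract s u ≢ []
contract-nonempty s  []          u≢[] = u≢[]
contract-nonempty s  (_ ∷ [])    _ ()
contract-nonempty 0ℙ (_ ∷ _ ∷ _) _ ()
contract-nonempty 1ℙ (_ ∷ _ ∷ _) _ ()

contract-shortens : ∀ s u → EvenLength u → u ≢ [] → length (contract s u) < length u
contract-shortens s []          _ u≢[] = ⊥-elim (u≢[] refl)
contract-shortens 0ℙ (_ ∷ _ ∷ []) e _ = s<s (s≤s z≤n)
contract-shortens 1ℙ (_ ∷ _ ∷ []) e _ = s<s (s≤s z≤n)
contract-shortens 0ℙ (_ ∷ _ ∷ u@(_ ∷ _)) e _ = s<s (m≤n⇒m≤1+n (contract-shortens 0ℙ u e λ ()))
contract-shortens 1ℙ (_ ∷ _ ∷ u@(_ ∷ _)) e _ = s<s (m≤n⇒m≤1+n (contract-shortens 1ℙ u e λ ()))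

contract-++ : ∀ s u v → EvenLength u → contract s (u ++ v) ≡ contract s u ++ contract s v
contract-++ s  []          v _ = refl
contract-++ 0ℙ (_ ∷ _ ∷ u) v e = cong (_ ∷_) (contract-++ 0ℙ u v e)
contract-++ 1ℙ (_ ∷ _ ∷ u) v e = cong (_ ∷_) (contract-++ 1ℙ u v e)

even-++ : ∀ u v → EvenLength u → EvenLength v → EvenLength (u ++ v)
even-++ []          v _ e = e
even-++ (_ ∷ _ ∷ u) v e f = even-++ u v e f

even-image : ∀ g {p} → All (EvenLength ∘ g) p → EvenLength (g ⟨ p ⟩)
even-image g []                = refl
even-image g (_∷_ {a} {p} e es) = even-++ (g a) (g ⟨ p ⟩) e (even-image g es)

contract-image : ∀ s g {p} → All (EvenLength ∘ g) p → contract s (g ⟨ p ⟩) ≡ (contract s ∘ g) ⟨ p ⟩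
contract-image s g []                 = refl
contract-image s g (_∷_ {a} {p} e es) =
  trans (contract-++ s (g a) (g ⟨ p ⟩) e) (cong (contract s (g a) ++_) (contract-image s g es))

-- Each pair of letters covers one odd position `2k + 1`, whose complemented letter is `d k`. For
-- either parity of `x` these `k` run consecutively from `⌊ x /2⌋`.
occurs-contract : ∀ {s} u x → parity x ≡ s → EvenLength u → Occurs u x → Occurs (contract s u) ⌊ x /2⌋
occurs-contract []          x p e o = tt
occurs-contract {0ℙ} (a ∷ b ∷ u) x p e (_ , eb , o) =
  trans (cong opposite (trans eb (d-at-odd (suc x) (trans (parity-suc x) (cong ℙ._⁻¹ p)))))
    (trans (opposite-involutive _) (cong d (half-suc x p))) ,
  occurs-contract u (suc (suc x)) p e o
  where
  half-suc : ∀ n → parity n ≡ 0ℙ → ⌊ suc n /2⌋ ≡ ⌊ n /2⌋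
  half-suc 0             _ = refl
  half-suc (suc (suc n)) p = cong suc (half-suc n p)
occurs-contract {1ℙ} (a ∷ b ∷ u) x p e (ea , _ , o) =
  trans (cong opposite (trans ea (d-at-odd x p))) (opposite-involutive _) ,
  occurs-contract u (suc (suc x)) p e o

-- Infinite descent on the length of the image of the first letter.
avoids-by-descent : ∀ a p →
  (∀ g → NonErasing g → ∀ x → Occurs (g ⟨ a ∷ p ⟩) x → All (EvenLength ∘ g) (a ∷ p)) →
  ¬ Encounters d (a ∷ p)
avoids-by-descent a p even (g , ne , f) with factor⇒occurs (g ⟨ a ∷ p ⟩) f
... | x , o = go g ne x o (<-wellFounded (length (g a)))
  where
  go : ∀ g → NonErasing g → ∀ x → Occurs (g ⟨ a ∷ p ⟩) x → Acc _<_ (length (g a)) → ⊥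
  go g ne x o (acc rs) with even g ne x o
  -- As all images have even length, each starts at a position of the parity of `x`, so one `s`
  -- contracts them all consistently.
  ... | es@(e ∷ _) = go (contract s ∘ g) (λ b → contract-nonempty s (g b) (ne b)) ⌊ x /2⌋
    (subst (λ u → Occurs u ⌊ x /2⌋) (contract-image s g es) (occurs-contract _ x refl (even-image g es) o))
    (rs (contract-shortens s (g a) e (ne a)))
    where s = parity x

-- For odd length the second copy is an odd shift of the first, which forces `u` to be 0 and the
-- whole word to be 0000.
even-0000 : ∀ u {x} → u ≢ [] → Occurs (u ++ u ++ u ++ u ++ []) x → EvenLength u
even-0000 u {x} u≢[] o with parity (length u) in p
... | 0ℙ = refl
... | 1ℙ with occurs-++ u o
... | o₀ , r with occurs-++ u r
... | o₁ , _ with odd-shift-square u (length u) p u≢[] o₀ o₁ o₁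
... | refl = ⊥-elim (no-0000 x o)

no-000v0v00 : ∀ v {x} → v ≢ [] → ¬ Occurs (0F ∷ 0F ∷ 0F ∷ v ++ 0F ∷ v ++ 0F ∷ 0F ∷ []) x
no-000v0v00 []       v≢[] _ = v≢[] refl
no-000v0v00 v@(b ∷ _) {x} _ (z₀ , z₁ , z₂ , o) with parity x in p
... | 1ℙ = no-zeros-two-apart x p z₀ z₂
... | 0ℙ with occurs-++ v o
... | (eb , _) , (_ , o′) with occurs-++ v o′
... | (eb′ , _) , (_ , z , _) with b
... | 0F = no-0000 x (z₀ , z₁ , z₂ , eb , tt)
-- The 1 opening the second `v` sits at an odd position, so `v` has odd length. The second and the
-- last 0 of the word lie at odd positions `4 + 2 * length v` apart.
... | 1F = no-odd-zeros-4r+6-apart x (length v) p q-odd z₁ z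
  where
  q-odd : parity (length v) ≡ 1ℙ
  q-odd = trans (sym (trans (+-homo-+ x (length v)) (cong (ℙ._+ parity (length v)) p)))
    (one-at-odd (4 + x + length v) (sym eb′))

even-00010100 : ∀ u v {x} → u ≢ [] → v ≢ [] →
  Occurs (u ++ u ++ u ++ v ++ u ++ v ++ u ++ u ++ []) x → EvenLength u × EvenLength v
even-00010100 u v {x} u≢[] v≢[] o with occurs-++ u o
... | o₀ , r₁ with occurs-++ u r₁
... | o₁ , r₂ with occurs-++ u r₂
... | _  , r₃ with occurs-++ v r₃
... | _  , r₄ with occurs-++ u r₄
... | o₄ , _  with parity (length u) in p | parity (length v) in q
... | 0ℙ | 0ℙ = refl , refl
-- The `u` between the two copies of `v` is shifted from the first by `3n + m`, which is odd. So `u`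
-- would be the single letter 0, contradicting its even length.
... | 0ℙ | 1ℙ = case trans (sym p) (cong (parity ∘ length) u≡0) of λ ()
  where
  n = length u
  m = length v
  odd-shift : parity (n + n + n + m) ≡ 1ℙ
  odd-shift rewrite +-homo-+ (n + n + n) m | +-homo-+ (n + n) n | parity-double n | p | q = refl
  regroup : ∀ x n m → x + n + n + n + m ≡ x + (n + n + n + m)
  regroup = solve-∀
  u≡0 : u ≡ 0F ∷ []
  u≡0 = odd-shift-square u (n + n + n + m) odd-shift u≢[] o₀ o₁ (subst (Occurs u) (regroup x n m) o₄)
-- Here the adjacent copy of `u` already is an odd shift.
... | 1ℙ | _ with odd-shift-square u (length u) p u≢[] o₀ o₁ o₁
... | refl = ⊥-elim (no-000v0v00 v v≢[] o)

corollary2p6 : Good d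
corollary2p6 = record
  { no-11           = λ f → no-11-at (factor⇒occurs _ f)
  ; no-1001         = λ f → no-1001-at (factor⇒occurs _ f)
  ; avoids-0000     = avoids-by-descent _ _ λ g ne x o → let e = even-0000 (g 0F) (ne 0F) o in e ∷ e ∷ e ∷ e ∷ []
  ; avoids-00010100 = avoids-by-descent _ _ λ g ne x o →
      let (e , f) = even-00010100 (g 0F) (g 1F) (ne 0F) (ne 1F) o
      in e ∷ e ∷ e ∷ f ∷ e ∷ f ∷ e ∷ e ∷ []
  }
  where
  no-11-at : ¬ (∃[ x ] Occurs (1F ∷ 1F ∷ []) x)
  no-11-at (x , e , e′ , _) =
    odd-suc-not-odd x (one-at-odd x (sym e)) (one-at-odd (suc x) (sym e′))
  no-1001-at : ¬ (∃[ x ] Occurs (1F ∷ 0F ∷ 0F ∷ 1F ∷ []) x)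
  no-1001-at (x , e , _ , _ , e′ , _) =
    -- `parity (3 + x)` computes to `parity (suc x)`.
    odd-suc-not-odd x (one-at-odd x (sym e)) (one-at-odd (3 + x) (sym e′))
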